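{- Let $q=p^n$ be a prime power, let $d_1,d_2\ge 1$ be integers, let $P(X,Z)\in\mathbb{F}_q[X,Z]$ be monic in $Z$ with $\deg_Z P\ge 2$ and let $Q(X,Y,Z)\in\mathbb{F}_q[X,Y,Z]$ be monic in $Y$ with $\deg_Y Q\ge 2$. Let $$S_{d_1,d_2}(\mathbb{F}_q)=\{(\alpha,\beta,\gamma,\kappa)\in\mathbb{F}_q^4\mid \alpha^{d_1}\beta=P(\alpha,\gamma),\ \alpha^{d_2}\kappa=Q(\alpha,\beta,\gamma)\}.$$ Then: (1) if $P(0,Z)=Z^2$ and $Q(0,Y,Z)=Y^2$, then $\#S_{d_1,d_2}(\mathbb{F}_q)=q^2$, which is the $q$-th square number $S_4(q)$; (2) if $P(0,Z)=Z^q-Z$ and $Q(0,Y,Z)=Y^2$, then $\#S_{d_1,d_2}(\mathbb{F}_q)=2q^2-q$, which is the $q$-th hexagonal number $S_6(q)$; (3) if $P(0,Z)=Z^q-Z$ and $Q(0,Y,Z)=Y^2-ZY$, then $\#S_{d_1,d_2}(\mathbb{F}_q)=3q^2-2q$, which is the $q$-th octagonal number $S_8(q)$; (4) if $P(0,Z)=Z^q-Z$ and $Q(0,Y,Z)=Y^4-Y+Z(Y^2-Y)$, then $\#S_{d_1,d_2}(\mathbb{F}_q)=4q^2-3q$, which is the $q$-th decagonal number $S_{10}(q)$.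
   Context: $\mathbb{F}_q$ is the finite field with $q$ elements. For $m\ge 3$, the $n$-th $m$-gonal number is $S_m(n)=\sum_{k=0}^{n-1}(1+k(m-2))=\frac{n}{2}\bigl((m-2)n-(m-4)\bigr)$. "Monic in $Z$" means that, viewed as a polynomial in $Z$ with coefficients in the ring of polynomials in the other variables, the leading coefficient is $1$; similarly for "monic in $Y$". -}

module Defs where

open import Level using (Level; _⊔_)
open import Algebra.Bundles using (RawRing; CommutativeRing)
open import Algebra.Apartness.Bundles using (HeytingField; HeytingCommutativeRing)
import Algebra.Definitions.RawSemiring as RawSemiringDefs
open import Data.Fin.Base using (Fin)
open import Data.List.Base using (List; []; _∷_; foldr; map; upTo)
open import Data.Nat.Base as ℕ using (ℕ; zero; suc)
open import Data.Nat.ListAction using (sum)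
open import Data.Product.Base using (Σ; ∃-syntax; _×_; _,_; proj₁)
open import Data.Product.Relation.Binary.Pointwise.NonDependent using (_×ₛ_)
open import Function.Bundles using (Inverse)
open import Relation.Binary.Bundles using (Setoid)
import Relation.Binary.Construct.On as On
import Relation.Binary.PropositionalEquality.Properties as ≡

private
  variable
    c ℓ ℓ₁ ℓ₂ : Level

HasCardinality : Setoid c ℓ → ℕ → Set (c ⊔ ℓ)
HasCardinality S n = Inverse S (≡.setoid (Fin n))

-- The n-th m-gonal number.  Meaningful for m ≥ 3, where m ∸ 2 is the
-- ordinary difference.
polygonal : ℕ → ℕ → ℕ
polygonal m n = sum (map (λ k → 1 ℕ.+ k ℕ.* (m ℕ.∸ 2)) (upTo n))

module RingOps (R : RawRing c ℓ) where
  open RawRing R public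
  open RawSemiringDefs rawSemiring public using (_^_)

  infixl 6 _-_
  _-_ : Carrier → Carrier → Carrier
  x - y = x + (- y)

-- One-variable polynomials as lists of coefficients, constant term first.
-- Trailing zeros are allowed: two polynomials are identified when all their
-- coefficients agree.
module _ (R : RawRing c ℓ) where
  open RawRing R

  private
    Poly : Set c
    Poly = List Carrier

  coeff : Poly → ℕ → Carrier
  coeff []      _       = 0#
  coeff (a ∷ _) zero    = a
  coeff (_ ∷ p) (suc i) = coeff p i

  private
    add : Poly → Poly → Poly
    add []      q       = q
    add (a ∷ p) []      = a ∷ p
    add (a ∷ p) (b ∷ q) = (a + b) ∷ add p q

    mul : Poly → Poly → Poly
    mul []      q = []
    mul (a ∷ p) q = add (map (a *_) q) (0# ∷ mul p q)

  polynomialRing : RawRing c ℓ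
  polynomialRing = record
    { Carrier = Poly
    ; _≈_     = λ p q → ∀ i → coeff p i ≈ coeff q i
    ; _+_     = add
    ; _*_     = mul
    ; -_      = map (-_)
    ; 0#      = []
    ; 1#      = 1# ∷ []
    }

  constant : Carrier → Poly
  constant a = a ∷ []

  indeterminate : Poly
  indeterminate = 0# ∷ 1# ∷ []

  eval : Carrier → Poly → Carrier
  eval x = foldr (λ a r → a + x * r) 0#

  HasDegree : Poly → ℕ → Set ℓ
  HasDegree p d = coeff p d ≉ 0# × (∀ i → d ℕ.< i → coeff p i ≈ 0#)

  Monic : Poly → Set ℓ
  Monic p = ∃[ d ] HasDegree p d × coeff p d ≈ 1#

  DegreeAtLeast : ℕ → Poly → Set ℓ
  DegreeAtLeast k p = ∃[ d ] HasDegree p d × k ℕ.≤ d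

-- Fields are the library's Heyting fields.  When the carrier is finite,
-- equality is decidable, so every element that is not ≈ 0# is invertible and
-- the apartness relation carries no further content: these are exactly the
-- finite fields in the usual sense.
module FieldPolynomials (F : HeytingField c ℓ₁ ℓ₂) where

  private
    commutativeRing : CommutativeRing c ℓ₁
    commutativeRing = HeytingCommutativeRing.commutativeRing
                        (HeytingField.heytingCommutativeRing F)

  setoid : Setoid c ℓ₁
  setoid = CommutativeRing.setoid commutativeRing

  𝔽 : RawRing c ℓ₁
  𝔽 = CommutativeRing.rawRing commutativeRing

  -- A polynomial in several variables is a polynomial in the last-named
  -- variable over the polynomials in the others, so that degree and
  -- monicity in that variable are those of the outermost layer:
  --   𝔽[X,Z] = 𝔽[X][Z],  𝔽[X,Z,Y] = 𝔽[X][Z][Y],  𝔽[Z,Y] = 𝔽[Z][Y].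
  𝔽[X] 𝔽[X,Z] 𝔽[X,Z,Y] 𝔽[Z] 𝔽[Z,Y] : RawRing c ℓ₁
  𝔽[X]     = polynomialRing 𝔽
  𝔽[X,Z]   = polynomialRing 𝔽[X]
  𝔽[X,Z,Y] = polynomialRing 𝔽[X,Z]
  𝔽[Z]     = polynomialRing 𝔽
  𝔽[Z,Y]   = polynomialRing 𝔽[Z]

  private
    ∣_∣ : ∀ {a b} → RawRing a b → Set a
    ∣_∣ = RawRing.Carrier

  open RingOps 𝔽 using (_≈_; _*_; _^_; 0#)

  -- P(α,γ), coefficientwise in X first
  evalXZ : ∣ 𝔽[X,Z] ∣ → ∣ 𝔽 ∣ → ∣ 𝔽 ∣ → ∣ 𝔽 ∣
  evalXZ P α γ = eval 𝔽 γ (map (eval 𝔽 α) P)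

  -- Q(α,β,γ), the arguments being the values of X, Y, Z in this order.
  evalXYZ : ∣ 𝔽[X,Z,Y] ∣ → ∣ 𝔽 ∣ → ∣ 𝔽 ∣ → ∣ 𝔽 ∣ → ∣ 𝔽 ∣
  evalXYZ Q α β γ = eval 𝔽 β (map (λ r → evalXZ r α γ) Q)

  _⟨0,Z⟩ : ∣ 𝔽[X,Z] ∣ → ∣ 𝔽[Z] ∣
  P ⟨0,Z⟩ = map (eval 𝔽 0#) P

  _⟨0,Y,Z⟩ : ∣ 𝔽[X,Z,Y] ∣ → ∣ 𝔽[Z,Y] ∣
  Q ⟨0,Y,Z⟩ = map _⟨0,Z⟩ Q

  -- Subscript 1 marks the operations of 𝔽[Z], subscript 2 those of 𝔽[Z,Y].
  open RingOps 𝔽[Z] public using ()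
    renaming (_≈_ to _≈₁_; _-_ to _-₁_; _^_ to _^₁_)
  open RingOps 𝔽[Z,Y] public using ()
    renaming (_≈_ to _≈₂_; _+_ to _+₂_; _-_ to _-₂_; _*_ to _*₂_; _^_ to _^₂_)

  Z₁ : ∣ 𝔽[Z] ∣
  Z₁ = indeterminate 𝔽

  Y₂ Z₂ : ∣ 𝔽[Z,Y] ∣
  Y₂ = indeterminate 𝔽[Z]
  Z₂ = constant 𝔽[Z] Z₁

  IsSolution : ℕ → ℕ → ∣ 𝔽[X,Z] ∣ → ∣ 𝔽[X,Z,Y] ∣ →
               ∣ 𝔽 ∣ × ∣ 𝔽 ∣ × ∣ 𝔽 ∣ × ∣ 𝔽 ∣ → Set ℓ₁
  IsSolution d₁ d₂ P Q (α , β , γ , κ) =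
    (α ^ d₁ * β ≈ evalXZ P α γ) × (α ^ d₂ * κ ≈ evalXYZ Q α β γ)

  -- Solutions are compared as points of 𝔽⁴ only; the proofs of the
  -- equations play no role in counting.
  solutions : ℕ → ℕ → ∣ 𝔽[X,Z] ∣ → ∣ 𝔽[X,Z,Y] ∣ → Setoid (c ⊔ ℓ₁) ℓ₁
  solutions d₁ d₂ P Q = On.setoid 𝔽⁴ points
    where
    𝔽⁴ : Setoid c ℓ₁
    𝔽⁴ = setoid ×ₛ (setoid ×ₛ (setoid ×ₛ setoid))

    points : Σ (∣ 𝔽 ∣ × ∣ 𝔽 ∣ × ∣ 𝔽 ∣ × ∣ 𝔽 ∣) (IsSolution d₁ d₂ P Q) → ∣ 𝔽 ∣ × ∣ 𝔽 ∣ × ∣ 𝔽 ∣ × ∣ 𝔽 ∣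
    points = proj₁

{-# OPTIONS --safe #-}
-- Where α ≠ 0 the two equations determine β and κ from (α , γ), which gives
-- (q − 1) q solutions.  Where α = 0 they say that P(0,γ) = Q(0,β,γ) = 0 and
-- leave κ free, which gives m q solutions, m being the number of such (β , γ).
-- In the first case that curve is a point; in the others P(0,Z) = Z^q − Z
-- vanishes identically by Fermat, and the curve is a union of lines β = b and of
-- one graph γ = h(β) over the remaining β:
--   Y² − ZY = Y (Y − Z),  Y⁴ − Y + Z (Y² − Y) = Y (Y − 1) (Z + Y² + Y + 1),
-- so that m is 1, q, q + (q − 1) and 2q + (q − 2) respectively.
module Submission where

open import Defs
open import Level using (Level)
open import Algebra.Apartness.Bundles using (HeytingCommutativeRing; HeytingField)
import Algebra.Apartness.Properties.HeytingCommutativeRing as HeytingProperties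
open import Algebra.Bundles using (CommutativeRing; RawRing)
import Algebra.Morphism.Construct.Identity as IdentityMorphism
open import Algebra.Morphism.Structures using (module RingMorphisms)
import Algebra.Properties.CommutativeMonoid.Sum as CommutativeMonoidSum
import Algebra.Properties.Ring as RingProperties
import Algebra.Properties.Semiring.Exp as SemiringExp
import Algebra.Solver.Ring.NaturalCoefficients.Default as SemiringSolver
open import Data.Fin.Base using (Fin; zero; suc; punchIn; punchOut)
open import Data.Fin.Permutation using (Permutation′; permutation)
open import Data.Fin.Properties as Fin
  using (any?; *↔×; +↔⊎; punchIn-injective; punchIn-punchOut; punchInᵢ≢i)
open import Data.List.Base using ([]; _∷_; _++_; map; upTo)
open import Data.List.Properties using (map-++; map-cong; map-id; map-∘; upTo-∷ʳ)
open import Data.Nat.Base as ℕ using (ℕ; zero; suc)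
open import Data.Nat.ListAction using (sum)
open import Data.Nat.ListAction.Properties using (sum-++)
open import Data.Nat.Primality using (Prime)
open import Data.Nat.Properties as ℕ using (m+n∸n≡m)
open import Data.Nat.Tactic.RingSolver using (solve-∀)
open import Data.Product.Base using (_×_; _,_; proj₁; proj₂; ∃-syntax)
open import Data.Product.Function.NonDependent.Setoid using (_×-inverse_)
import Data.Product.Relation.Binary.Pointwise.NonDependent as ×
open import Data.Sum.Base using (inj₁; inj₂)
open import Data.Sum.Function.Setoid using (_⊎-inverse_)
import Data.Sum.Relation.Binary.Pointwise as ⊎
open import Data.Vec.Functional using (Vector; removeAt; replicate)
open import Function.Base using (id; _∘_)
open import Function.Bundles using (Injection; Inverse)
import Function.Construct.Composition as Composition
open import Function.Definitions using (Congruent; StrictlyInverseˡ; StrictlyInverseʳ)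
import Function.Consequences.Setoid as Consequences
open import Function.Properties.Inverse using (Inverse⇒Injection; ↔-sym)
open import Relation.Binary.Bundles using (Setoid)
import Relation.Binary.Construct.On as On
open import Relation.Binary.PropositionalEquality as ≡ using (_≡_; _≢_)
import Relation.Binary.Reasoning.Setoid as SetoidReasoning
open import Relation.Nullary using (¬_; Dec; yes; no; contradiction)
open import Relation.Nullary.Decidable using (via-injection)
open import Relation.Unary using (Pred; _∩_; ∁)

private
  variable
    a b c ℓ ℓ₁ ℓ₂ p r : Level
    m n : ℕ

-- Cardinality of setoids and of their subsets

infixl 5 _↾_
-- The same encoding as in `solutions`: only the underlying points are compared, so different proofs
-- of `P` at one point count once, and nested restrictions still compare the original points.
_↾_ : (S : Setoid a ℓ) → Pred (Setoid.Carrier S) p → Setoid _ ℓ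
S ↾ P = On.setoid S (proj₁ {B = P})

module _ {S : Setoid a ℓ₁} {T : Setoid b ℓ₂} where
  private
    module S = Setoid S
    module T = Setoid T

  -- For congruent maps the pointwise inverse laws imply the relational ones that `Inverse` asks
  -- for.
  strictInverse : (to : S.Carrier → T.Carrier) (from : T.Carrier → S.Carrier) →
                  Congruent S._≈_ T._≈_ to → Congruent T._≈_ S._≈_ from →
                  StrictlyInverseˡ T._≈_ to from → StrictlyInverseʳ S._≈_ to from →
                  Inverse S T
  strictInverse to from to-cong from-cong invˡ invʳ = record
    { to        = to
    ; from      = from
    ; to-cong   = to-cong
    ; from-cong = from-cong
    ; inverse   = strictlyInverseˡ⇒inverseˡ {f⁻¹ = from} to-cong invˡ
                , strictlyInverseʳ⇒inverseʳ {f = to} from-cong invʳ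
    } where open Consequences S T

  card-transport : Inverse S T → HasCardinality T n → HasCardinality S n
  card-transport = Composition.inverse

  card-× : HasCardinality S m → HasCardinality T n → HasCardinality (S ×.×ₛ T) (m ℕ.* n)
  card-× {m} {n} S≅m T≅n = Composition.inverse (S≅m ×-inverse T≅n)
    (Composition.inverse ×.Pointwise-≡↔≡ (↔-sym (*↔× {m} {n})))

  card-⊎ : HasCardinality S m → HasCardinality T n → HasCardinality (S ⊎.⊎ₛ T) (m ℕ.+ n)
  card-⊎ {m} {n} S≅m T≅n = Composition.inverse (S≅m ⊎-inverse T≅n)
    (Composition.inverse (⊎.Pointwise-≡↔≡ _ _) (↔-sym (+↔⊎ {m} {n})))

module _ (S : Setoid a ℓ) where
  open Setoid S

  split-inverse : {P : Pred Carrier p} → (∀ x → Dec (P x)) → (∀ {x y} → x ≈ y → P x → P y) →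
                  Inverse S ((S ↾ P) ⊎.⊎ₛ (S ↾ ∁ P))
  split-inverse {P = P} P? resp = strictInverse to from
    (λ {x} {y} → to-cong (P? x) (P? y))
    (λ { (⊎.inj₁ eq) → eq ; (⊎.inj₂ eq) → eq })
    (λ { (inj₁ (x , Px)) → to-from₁ (P? x) Px
       ; (inj₂ (x , ¬Px)) → to-from₂ (P? x) ¬Px })
    (λ x → from-to (P? x))
    where
    open Setoid ((S ↾ P) ⊎.⊎ₛ (S ↾ ∁ P)) using () renaming (Carrier to Halves; _≈_ to _≈ₕ_)

    -- The decision is an argument here, so that the laws below can match on the decisions for two
    -- equal points independently. `resp` excludes that such points land in different halves.
    side : ∀ {x} → Dec (P x) → Halves
    side (yes Px) = inj₁ (_ , Px)
    side (no ¬Px) = inj₂ (_ , ¬Px)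

    to : Carrier → Halves
    to x = side (P? x)

    from : Halves → Carrier
    from (inj₁ (x , _)) = x
    from (inj₂ (x , _)) = x

    to-cong : ∀ {x y} (Px? : Dec (P x)) (Py? : Dec (P y)) → x ≈ y → side Px? ≈ₕ side Py?
    to-cong (yes _)  (yes _)  eq = ⊎.inj₁ eq
    to-cong (yes Px) (no ¬Py) eq = contradiction (resp eq Px) ¬Py
    to-cong (no ¬Px) (yes Py) eq = contradiction (resp (sym eq) Py) ¬Px
    to-cong (no _)   (no _)   eq = ⊎.inj₂ eq

    to-from₁ : ∀ {x} (Px? : Dec (P x)) (Px : P x) → side Px? ≈ₕ inj₁ (x , Px)
    to-from₁ (yes _)  _  = ⊎.inj₁ refl
    to-from₁ (no ¬Px) Px = contradiction Px ¬Px

    to-from₂ : ∀ {x} (Px? : Dec (P x)) (¬Px : ¬ P x) → side Px? ≈ₕ inj₂ (x , ¬Px)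
    to-from₂ (yes Px) ¬Px = contradiction Px ¬Px
    to-from₂ (no _)   _   = ⊎.inj₂ refl

    from-to : ∀ {x} (Px? : Dec (P x)) → from (side Px?) ≈ x
    from-to (yes _) = refl
    from-to (no _)  = refl

  card-split : {P : Pred Carrier p} → (∀ x → Dec (P x)) → (∀ {x y} → x ≈ y → P x → P y) →
               HasCardinality (S ↾ P) m → HasCardinality (S ↾ ∁ P) n → HasCardinality S (m ℕ.+ n)
  card-split P? resp P≅m ∁P≅n = card-transport (split-inverse P? resp) (card-⊎ P≅m ∁P≅n)

  card-∩ : {P : Pred Carrier p} {R : Pred Carrier r} →
           HasCardinality (S ↾ P ↾ R ∘ proj₁) n → HasCardinality (S ↾ P ∩ R) n
  card-∩ = card-transport (strictInverse
    (λ (x , Px , Rx) → (x , Px) , Rx) (λ ((x , Px) , Rx) → x , Px , Rx)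
    id id (λ _ → refl) (λ _ → refl))

  card-empty : {P : Pred Carrier p} → (∀ x → ¬ P x) → HasCardinality (S ↾ P) 0
  card-empty ¬P = strictInverse (λ (x , Px) → contradiction Px (¬P x)) (λ ())
    (λ {(x , Px)} → contradiction Px (¬P x)) (λ { {()} }) (λ ()) (λ (x , Px) → contradiction Px (¬P x))

  card-singleton : ∀ x → HasCardinality (S ↾ (_≈ x)) 1
  card-singleton x = strictInverse (λ _ → zero) (λ _ → x , refl)
    (λ _ → ≡.refl) (λ _ → refl) (λ { zero → ≡.refl }) (λ (y , y≈x) → sym y≈x)

  -- Removing `x` amounts to deleting its index from `Fin (suc n)`; `punchOut` and `punchIn` at
  -- `to x` renumber the remaining indices.
  card-remove : HasCardinality S (suc n) → ∀ x → HasCardinality (S ↾ (λ y → ¬ y ≈ x)) n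
  card-remove {n} S≅1+n x = strictInverse
    (λ (y , y≉x) → punchOut (≢x y≉x))
    (λ i → from (punchIn (to x) i) , λ eq → punchInᵢ≢i (to x) i (from-injective eq))
    (λ eq → Fin.punchOut-cong (to x) (to-cong eq))
    (λ { ≡.refl → refl })
    (λ i → punchIn-injective (to x) _ _
      (≡.trans (punchIn-punchOut _) (strictlyInverseˡ _)))
    (λ (y , y≉x) → trans (from-cong (punchIn-punchOut (≢x y≉x))) (strictlyInverseʳ y))
    where
    open Inverse S≅1+n
    ≢x : ∀ {y} → ¬ y ≈ x → to x ≢ to y
    ≢x y≉x eq = y≉x (trans (sym (strictlyInverseʳ _)) (inverseʳ (≡.sym eq)))
    from-injective : ∀ {i} → from i ≈ x → i ≡ to x
    from-injective eq = ≡.trans (≡.sym (strictlyInverseˡ _)) (to-cong eq)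

-- Evaluation of polynomials

module _ (R : RawRing a ℓ) (A : CommutativeRing b r) where
  private
    module R = RawRing R
    R[X] = polynomialRing R
    module R[X] = RawRing R[X]
  open CommutativeRing A hiding (zero)
  open RingMorphisms R rawRing using (IsRingHomomorphism)
  open RingMorphisms R[X] rawRing using () renaming (IsRingHomomorphism to IsRingHomomorphism[X])
  open RingProperties ring using (-0#≈0#; -‿+-comm; -‿distribʳ-*)
  open SetoidReasoning setoid
  open SemiringSolver commutativeSemiring using (solve; _:=_; _:+_; _:*_)

  module _ (φ : R.Carrier → Carrier) (φ-hom : IsRingHomomorphism φ) (x : Carrier) where
    private
      module φ = IsRingHomomorphism φ-hom

    -- Keeping `φ` general makes the construction iterable: the identity gives evaluation on `𝔽[Z]`,
    -- and that evaluation, taken as the new `φ`, gives evaluation on `𝔽[Z,Y]`. All ring laws are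
    -- applied in `A`.
    evalAlong : R[X].Carrier → Carrier
    evalAlong p = eval rawRing x (map φ p)

    private
      ev = evalAlong

      -- Equal polynomials may be lists of different lengths. The mixed cases show that surplus
      -- coefficients, all sent to zero by `φ`, contribute nothing.
      cong : ∀ p q → (∀ i → φ (coeff R p i) ≈ φ (coeff R q i)) → ev p ≈ ev q
      cong []      []      eq = refl
      cong []      (b ∷ q) eq = begin
        0#              ≈⟨ trans (+-identityˡ _) (zeroʳ x) ⟨
        0# + x * 0#     ≈⟨ +-cong (trans (sym φ.0#-homo) (eq 0)) (*-congˡ (cong [] q (eq ∘ suc))) ⟩
        φ b + x * ev q  ∎
      cong (a ∷ p) []      eq = begin
        φ a + x * ev p  ≈⟨ +-cong (trans (eq 0) φ.0#-homo) (*-congˡ (cong p [] (eq ∘ suc))) ⟩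
        0# + x * 0#     ≈⟨ trans (+-identityˡ _) (zeroʳ x) ⟩
        0#              ∎
      cong (a ∷ p) (b ∷ q) eq = +-cong (eq 0) (*-congˡ (cong p q (eq ∘ suc)))

      +-homo : ∀ p q → ev (p R[X].+ q) ≈ ev p + ev q
      +-homo []      q       = sym (+-identityˡ _)
      +-homo (a ∷ p) []      = sym (+-identityʳ _)
      +-homo (a ∷ p) (b ∷ q) = begin
        φ (a R.+ b) + x * ev (p R[X].+ q)    ≈⟨ +-cong (φ.+-homo a b) (*-congˡ (+-homo p q)) ⟩
        (φ a + φ b) + x * (ev p + ev q)      ≈⟨ solve 5 (λ a b x p q →
          (a :+ b) :+ x :* (p :+ q) := (a :+ x :* p) :+ (b :+ x :* q)) refl (φ a) (φ b) x (ev p) (ev q) ⟩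
        (φ a + x * ev p) + (φ b + x * ev q)  ∎

      scale-homo : ∀ a q → ev (map (a R.*_) q) ≈ φ a * ev q
      scale-homo a []      = sym (zeroʳ _)
      scale-homo a (b ∷ q) = begin
        φ (a R.* b) + x * ev (map (a R.*_) q)  ≈⟨ +-cong (φ.*-homo a b) (*-congˡ (scale-homo a q)) ⟩
        φ a * φ b + x * (φ a * ev q)           ≈⟨ solve 4 (λ a b x q →
          a :* b :+ x :* (a :* q) := a :* (b :+ x :* q)) refl (φ a) (φ b) x (ev q) ⟩
        φ a * (φ b + x * ev q)                 ∎

      -- Follows the recursion of the product: a scaled copy of `q` plus a shifted product, where
      -- the leading `0#` of the shift is sent to zero.
      *-homo : ∀ p q → ev (p R[X].* q) ≈ ev p * ev q
      *-homo []      q = sym (zeroˡ _)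
      *-homo (a ∷ p) q = begin
        ev (map (a R.*_) q R[X].+ (R.0# ∷ p R[X].* q))         ≈⟨ +-homo (map (a R.*_) q) _ ⟩
        ev (map (a R.*_) q) + (φ R.0# + x * ev (p R[X].* q))   ≈⟨ +-cong (scale-homo a q)
          (trans (+-congʳ φ.0#-homo) (trans (+-identityˡ _) (*-congˡ (*-homo p q)))) ⟩
        φ a * ev q + x * (ev p * ev q)                         ≈⟨ solve 4 (λ a x p q →
          a :* q :+ x :* (p :* q) := (a :+ x :* p) :* q) refl (φ a) x (ev p) (ev q) ⟩
        (φ a + x * ev p) * ev q                                ∎

      -‿homo : ∀ p → ev (R[X].- p) ≈ - ev p
      -‿homo []      = sym -0#≈0#
      -‿homo (a ∷ p) = begin
        φ (R.- a) + x * ev (R[X].- p)  ≈⟨ +-cong (φ.-‿homo a) (*-congˡ (-‿homo p)) ⟩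
        - φ a + x * - ev p             ≈⟨ +-congˡ (-‿distribʳ-* x (ev p)) ⟨
        - φ a + - (x * ev p)           ≈⟨ -‿+-comm _ _ ⟩
        - (φ a + x * ev p)             ∎

    evalAlong-constant : ∀ a → ev (constant R a) ≈ φ a
    evalAlong-constant a = trans (+-congˡ (zeroʳ x)) (+-identityʳ _)

    evalAlong-indeterminate : ev (indeterminate R) ≈ x
    evalAlong-indeterminate = begin
      φ R.0# + x * ev (constant R R.1#)  ≈⟨ +-cong φ.0#-homo (*-congˡ (trans (evalAlong-constant R.1#) φ.1#-homo)) ⟩
      0# + x * 1#                        ≈⟨ trans (+-identityˡ _) (*-identityʳ x) ⟩
      x                                  ∎

    evalAlong-isRingHomomorphism : IsRingHomomorphism[X] evalAlong
    evalAlong-isRingHomomorphism = record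
      { isSemiringHomomorphism = record
        { isNearSemiringHomomorphism = record
          { +-isMonoidHomomorphism = record
            { isMagmaHomomorphism = record
              { isRelHomomorphism = record { cong = λ {p} {q} p≈q → cong p q (λ i → φ.⟦⟧-cong (p≈q i)) }
              ; homo              = +-homo
              }
            ; ε-homo = refl
            }
          ; *-homo = *-homo
          }
        ; 1#-homo = trans (evalAlong-constant R.1#) φ.1#-homo
        }
      ; -‿homo = -‿homo
      }

module _ {R : RawRing a ℓ} {A : CommutativeRing b r} where
  private
    module R = RingOps R
    module A = RingOps (CommutativeRing.rawRing A)
  open CommutativeRing A using (_≈_; refl; trans; *-congˡ; +-congˡ; rawRing)
  open RingMorphisms R rawRing using (IsRingHomomorphism)

  module _ {φ : R.Carrier → A.Carrier} (φ-hom : IsRingHomomorphism φ) where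
    open IsRingHomomorphism φ-hom

    ^-homo : ∀ x k → φ (x R.^ k) ≈ φ x A.^ k
    ^-homo x zero    = 1#-homo
    ^-homo x (suc k) = trans (*-homo x _) (*-congˡ (^-homo x k))

    minus-homo : ∀ x y → φ (x R.- y) ≈ φ x A.- φ y
    minus-homo x y = trans (+-homo x _) (+-congˡ (-‿homo y))

-- Finite fields

private
  commutativeRing : HeytingField c ℓ₁ ℓ₂ → CommutativeRing c ℓ₁
  commutativeRing F = HeytingCommutativeRing.commutativeRing (HeytingField.heytingCommutativeRing F)

module FiniteField (F : HeytingField c ℓ₁ ℓ₂)
                   (F≅n : HasCardinality (FieldPolynomials.setoid F) n) where
  open CommutativeRing (commutativeRing F) hiding (zero)
  open SemiringExp semiring using (_^_)
  open SetoidReasoning setoid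
  open Inverse F≅n using (strictlyInverseʳ) renaming (to to index; from to element)

  1≉0 : 1# ≉ 0#
  1≉0 1≈0 = HeytingField.#-irrefl F 1≈0 (HeytingProperties.1#0 (HeytingField.heytingCommutativeRing F))

  _≟_ : ∀ x y → Dec (x ≈ y)
  _≟_ = via-injection (Inverse⇒Injection F≅n) Fin._≟_

  -- A Heyting field only inverts the elements apart from 0#.  Searching the
  -- finite carrier makes invertibility decidable, so x ≉ 0# is enough.
  inverse : ∀ {x} → x ≉ 0# → ∃[ y ] x * y ≈ 1#
  inverse {x} x≉0 with any? (λ i → (x * element i) ≟ 1#)
  ... | yes (i , eq) = element i , eq
  ... | no none      = contradiction (proj₁ (HeytingField.tight F x 0#) ¬x#0) x≉0
    where
    -- If `x` were apart from zero, its inverse would have been found by the search, at the index of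
    -- `y`. Tightness then turns the failure of apartness into `x ≈ 0#`.
    ¬x#0 : ¬ HeytingField._#_ F x 0#
    ¬x#0 x#0 with HeytingField.#⇒invertible F x#0
    ... | y , _ , xy≈1 = none (index y , (begin
      x * element (index y)  ≈⟨ *-cong (sym (HeytingProperties.x-0≈x (HeytingField.heytingCommutativeRing F) x)) (strictlyInverseʳ y) ⟩
      (x - 0#) * y           ≈⟨ xy≈1 ⟩
      1#                     ∎))

  *-cancelˡ : ∀ {x y z} → x ≉ 0# → x * y ≈ x * z → y ≈ z
  *-cancelˡ {x} {y} {z} x≉0 xy≈xz with inverse x≉0
  ... | x⁻¹ , xx⁻¹≈1 = begin
    y              ≈⟨ shift y ⟩
    x⁻¹ * (x * y)  ≈⟨ *-congˡ xy≈xz ⟩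
    x⁻¹ * (x * z)  ≈⟨ shift z ⟨
    z              ∎
    where
    shift : ∀ w → w ≈ x⁻¹ * (x * w)
    shift w = begin
      w              ≈⟨ *-identityˡ w ⟨
      1# * w         ≈⟨ *-congʳ (trans (*-comm x⁻¹ x) xx⁻¹≈1) ⟨
      x⁻¹ * x * w    ≈⟨ *-assoc x⁻¹ x w ⟩
      x⁻¹ * (x * w)  ∎

  *≈0⇒≈0 : ∀ {x y} → x ≉ 0# → x * y ≈ 0# → y ≈ 0#
  *≈0⇒≈0 x≉0 xy≈0 = *-cancelˡ x≉0 (trans xy≈0 (sym (zeroʳ _)))

  *-≉0 : ∀ {x y} → x ≉ 0# → y ≉ 0# → x * y ≉ 0#
  *-≉0 x≉0 y≉0 xy≈0 = y≉0 (*≈0⇒≈0 x≉0 xy≈0)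

  ^-≉0 : ∀ {x} k → x ≉ 0# → x ^ k ≉ 0#
  ^-≉0 zero    x≉0 = 1≉0
  ^-≉0 (suc k) x≉0 = *-≉0 x≉0 (^-≉0 k x≉0)

  divide : ∀ {x} → x ≉ 0# → ∀ y → ∃[ z ] x * z ≈ y
  divide {x} x≉0 y with inverse x≉0
  ... | x⁻¹ , xx⁻¹≈1 = x⁻¹ * y , (begin
    x * (x⁻¹ * y)  ≈⟨ *-assoc x x⁻¹ y ⟨
    x * x⁻¹ * y    ≈⟨ *-congʳ xx⁻¹≈1 ⟩
    1# * y         ≈⟨ *-identityˡ y ⟩
    y              ∎)

-- Fermat's little theorem.

module _ (F : HeytingField c ℓ₁ ℓ₂)
         (F≅1+n : HasCardinality (FieldPolynomials.setoid F) (suc n)) where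
  open CommutativeRing (commutativeRing F) hiding (zero)
  open SemiringExp semiring using (_^_)
  open CommutativeMonoidSum *-commutativeMonoid
    using (sum-remove; ∑-distrib-+; sum-permute; sum-cong-≋; sum-replicate; sum-replicate-zero)
    renaming (sum to ∏)
  open SetoidReasoning setoid
  open FiniteField F F≅1+n
  open Inverse F≅1+n using (strictlyInverseˡ; strictlyInverseʳ)
    renaming (to to index; from to element; to-cong to index-cong)

  private
    ifZero : ∀ {y} → Dec (y ≈ 0#) → Carrier → Carrier → Carrier
    ifZero (yes _) u v = u
    ifZero (no _)  u v = v

    -- Putting `1#` in the place of zero lets the product of the units run over all of
    -- `Fin (suc n)`, where permutations act.
    nonzeroPart : Carrier → Carrier
    nonzeroPart y = ifZero (y ≟ 0#) 1# y

    ∏-≉0 : ∀ {k} (f : Vector Carrier k) → (∀ i → f i ≉ 0#) → ∏ f ≉ 0#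
    ∏-≉0 {zero}  f f≉0 = 1≉0
    ∏-≉0 {suc k} f f≉0 = *-≉0 (f≉0 zero) (∏-≉0 (f ∘ suc) (f≉0 ∘ suc))

    nonzeroPart-≉0 : ∀ y → nonzeroPart y ≉ 0#
    nonzeroPart-≉0 y with y ≟ 0#
    ... | yes _  = 1≉0
    ... | no y≉0 = y≉0

    module _ {x} (x≉0 : x ≉ 0#) where
      defect : Carrier → Carrier
      defect y = ifZero (y ≟ 0#) x 1#

      -- Multiplication by `x⁻¹` is the inverse; both are carried to indices, the form in which
      -- `sum-permute` reorders a product.
      multiplication : Permutation′ (suc n)
      multiplication = permutation (λ i → index (x * element i)) (λ i → index (x⁻¹ * element i))
        (inverts xx⁻¹≈1) (inverts (trans (*-comm x⁻¹ x) xx⁻¹≈1))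
        where
        x⁻¹ = inverse x≉0 .proj₁
        xx⁻¹≈1 = inverse x≉0 .proj₂
        inverts : ∀ {y z} → y * z ≈ 1# → ∀ i → index (y * element (index (z * element i))) ≡ i
        inverts {y} {z} yz≈1 i = ≡.trans (index-cong (begin
          y * element (index (z * element i))  ≈⟨ *-congˡ (strictlyInverseʳ _) ⟩
          y * (z * element i)                  ≈⟨ *-assoc y z _ ⟨
          y * z * element i                    ≈⟨ *-congʳ yz≈1 ⟩
          1# * element i                       ≈⟨ *-identityˡ _ ⟩
          element i                            ∎)) (strictlyInverseˡ i)

      -- At zero entries the factor x survives; elsewhere multiplication by x
      -- just moves to another entry.
      scale-nonzeroPart : ∀ {y z} → z ≈ x * y → x * nonzeroPart y ≈ nonzeroPart z * defect y
      scale-nonzeroPart {y} {z} z≈xy with y ≟ 0# | z ≟ 0#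
      ... | yes _   | yes _   = *-comm x 1#
      ... | yes y≈0 | no z≉0  = contradiction (trans z≈xy (trans (*-congˡ y≈0) (zeroʳ x))) z≉0
      ... | no y≉0  | yes z≈0 = contradiction (trans (sym z≈xy) z≈0) (*-≉0 x≉0 y≉0)
      ... | no _    | no _    = trans (sym z≈xy) (sym (*-identityʳ z))

      defect-zero : ∀ {y} → y ≈ 0# → defect y ≈ x
      defect-zero {y} y≈0 with y ≟ 0#
      ... | yes _  = refl
      ... | no y≉0 = contradiction y≈0 y≉0

      defect-nonzero : ∀ {y} → y ≉ 0# → defect y ≈ 1#
      defect-nonzero {y} y≉0 with y ≟ 0#
      ... | yes y≈0 = contradiction y≈0 y≉0
      ... | no _    = refl

      -- Only the index of `0#` contributes a factor other than `1#`, so that entry is split off.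
      ∏-defect : ∏ (defect ∘ element) ≈ x
      ∏-defect = begin
        ∏ (defect ∘ element)                                         ≈⟨ sum-remove {i = index 0#} (defect ∘ element) ⟩
        defect (element (index 0#)) * ∏ (removeAt (defect ∘ element) (index 0#))
          ≈⟨ *-cong (defect-zero (strictlyInverseʳ 0#)) (sum-cong-≋ (λ j → defect-nonzero (others j))) ⟩
        x * ∏ (replicate n 1#)                                       ≈⟨ *-congˡ (sum-replicate-zero n) ⟩
        x * 1#                                                       ≈⟨ *-identityʳ x ⟩
        x                                                            ∎
        where
        others : ∀ j → element (punchIn (index 0#) j) ≉ 0#
        others j eq = punchInᵢ≢i (index 0#) j (≡.trans (≡.sym (strictlyInverseˡ _)) (index-cong eq))

      -- Scale every entry of the product of units by `x`. The permutation `multiplication` restores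
      -- the product, except that a factor `x` is left over at the entry of zero. Cancelling the
      -- product therefore gives `x ^ suc n ≈ x` directly, instead of `x ^ n ≈ 1#`.
      unit-fermat : x ^ suc n ≈ x
      unit-fermat = *-cancelˡ (∏-≉0 units (nonzeroPart-≉0 ∘ element)) (begin
        ∏ units * x ^ suc n                              ≈⟨ *-comm _ _ ⟩
        -- Sums in the multiplicative monoid are products, and multiples there are powers.
        x ^ suc n * ∏ units                              ≈⟨ *-congʳ (sum-replicate (suc n)) ⟨
        ∏ (replicate (suc n) x) * ∏ units                ≈⟨ ∑-distrib-+ {suc n} (λ _ → x) units ⟨
        ∏ (λ i → x * units i)                            ≈⟨ sum-cong-≋ {suc n} (λ i → scale-nonzeroPart {element i} (strictlyInverseʳ _)) ⟩
        ∏ (λ i → units (moved i) * defect (element i))   ≈⟨ ∑-distrib-+ (units ∘ moved) (defect ∘ element) ⟩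
        ∏ (units ∘ moved) * ∏ (defect ∘ element)         ≈⟨ *-cong (sym (sum-permute units multiplication)) ∏-defect ⟩
        ∏ units * x                                      ∎)
        where
        units : Vector Carrier (suc n)
        units = nonzeroPart ∘ element
        moved : Fin (suc n) → Fin (suc n)
        moved i = index (x * element i)

  fermat : ∀ x → x ^ suc n ≈ x
  fermat x with x ≟ 0#
  ... | no x≉0  = unit-fermat x≉0
  ... | yes x≈0 = trans (*-congʳ x≈0) (trans (zeroˡ _) (sym x≈0))

-- Counting solutions

module Counting (F : HeytingField c ℓ₁ ℓ₂) {r : ℕ}
                (F≅2+r : HasCardinality (FieldPolynomials.setoid F) (suc (suc r))) where
  open FieldPolynomials F using
    (𝔽[X,Z]; 𝔽[X,Z,Y]; 𝔽[Z]; 𝔽[Z,Y]; 𝔽; evalXZ; evalXYZ; _⟨0,Z⟩; _⟨0,Y,Z⟩; Z₁; Y₂; Z₂;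
     _≈₁_; _-₁_; _^₁_; _≈₂_; _+₂_; _-₂_; _*₂_; _^₂_; IsSolution; solutions)
  open CommutativeRing (commutativeRing F) hiding (zero)
  open SemiringExp semiring using (_^_; ^-congˡ)
  open RingProperties ring using (x∙y⁻¹≈ε⇒x≈y; x≈y⇒x∙y⁻¹≈ε; [y-z]x≈yx-zx; +-inverseˡ-unique; //-rightDividesʳ; //-rightDividesˡ)
  open SemiringSolver commutativeSemiring using (solve; _:=_; _:+_; _:*_; _:^_; con)
  open SetoidReasoning setoid
  open FiniteField F F≅2+r

  private
    -- In the form `2 + r`, the counts q - 1 and q - 2 become `suc r` and `r`, free of subtraction.
    q : ℕ
    q = suc (suc r)

  𝔽² : Setoid c ℓ₁
  𝔽² = setoid ×.×ₛ setoid

  eval-map-cong : {B : Set a} {f g : B → Carrier} → (∀ b → f b ≈ g b) →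
                  ∀ {x y} → x ≈ y → ∀ p → eval 𝔽 x (map f p) ≈ eval 𝔽 y (map g p)
  eval-map-cong f≈g x≈y []      = refl
  eval-map-cong f≈g x≈y (b ∷ p) = +-cong (f≈g b) (*-cong x≈y (eval-map-cong f≈g x≈y p))

  eval-cong : ∀ {x y} → x ≈ y → ∀ p → eval 𝔽 x p ≈ eval 𝔽 y p
  eval-cong x≈y []      = refl
  eval-cong x≈y (a ∷ p) = +-congˡ (*-cong x≈y (eval-cong x≈y p))

  evalXZ-cong : ∀ P {α α′ γ γ′} → α ≈ α′ → γ ≈ γ′ → evalXZ P α γ ≈ evalXZ P α′ γ′
  evalXZ-cong P α≈ γ≈ = eval-map-cong (eval-cong α≈) γ≈ P

  evalXYZ-cong : ∀ Q {α α′ β β′ γ γ′} → α ≈ α′ → β ≈ β′ → γ ≈ γ′ →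
                 evalXYZ Q α β γ ≈ evalXYZ Q α′ β′ γ′
  evalXYZ-cong Q α≈ β≈ γ≈ = eval-map-cong (λ r → evalXZ-cong r α≈ γ≈) β≈ Q

  0^-zero : ∀ {d x} → 1 ℕ.≤ d → x ≈ 0# → ∀ y → x ^ d * y ≈ 0#
  0^-zero {suc d} {x} _ x≈0 y = begin
    x * x ^ d * y   ≈⟨ *-congʳ (*-congʳ x≈0) ⟩
    0# * x ^ d * y  ≈⟨ *-congʳ (zeroˡ _) ⟩
    0# * y          ≈⟨ zeroˡ y ⟩
    0#              ∎

  module _ (P : RawRing.Carrier 𝔽[X,Z]) (Q : RawRing.Carrier 𝔽[X,Z,Y]) where

    Zeros : Pred (Carrier × Carrier) ℓ₁
    Zeros (β , γ) = evalXZ P 0# γ ≈ 0# × evalXYZ Q 0# β γ ≈ 0#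

    module _ {d₁ d₂ : ℕ} where
      private
        S : Setoid (c Level.⊔ ℓ₁) ℓ₁
        S = solutions d₁ d₂ P Q
        OnHyperplane : Pred (Setoid.Carrier S) ℓ₁
        OnHyperplane ((α , _) , _) = α ≈ 0#

      -- Cancelling `α ^ d₁` fixes `β`, after which cancelling `α ^ d₂` fixes `κ`. This supplies
      -- both the congruence and the inverse law of the lift in `complement-inverse`, whose
      -- quotients come from chosen inverses.
      solution-unique : ∀ {α β γ κ α′ β′ γ′ κ′} → α ≉ 0# →
        IsSolution d₁ d₂ P Q (α , β , γ , κ) → IsSolution d₁ d₂ P Q (α′ , β′ , γ′ , κ′) →
        α ≈ α′ → γ ≈ γ′ → β ≈ β′ × κ ≈ κ′
      solution-unique {α} {β} {γ} {κ} {α′} {β′} {γ′} {κ′} α≉0 (eqP , eqQ) (eqP′ , eqQ′) α≈ γ≈ = β≈ , κ≈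
        where
        β≈ : β ≈ β′
        β≈ = *-cancelˡ (^-≉0 d₁ α≉0) (begin
          α ^ d₁ * β      ≈⟨ eqP ⟩
          evalXZ P α γ    ≈⟨ evalXZ-cong P α≈ γ≈ ⟩
          evalXZ P α′ γ′  ≈⟨ eqP′ ⟨
          α′ ^ d₁ * β′    ≈⟨ *-congʳ (^-congˡ d₁ α≈) ⟨
          α ^ d₁ * β′     ∎)
        κ≈ : κ ≈ κ′
        κ≈ = *-cancelˡ (^-≉0 d₂ α≉0) (begin
          α ^ d₂ * κ          ≈⟨ eqQ ⟩
          evalXYZ Q α β γ     ≈⟨ evalXYZ-cong Q α≈ β≈ γ≈ ⟩
          evalXYZ Q α′ β′ γ′  ≈⟨ eqQ′ ⟨
          α′ ^ d₂ * κ′        ≈⟨ *-congʳ (^-congˡ d₂ α≈) ⟨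
          α ^ d₂ * κ′         ∎)

      hyperplane-inverse : 1 ℕ.≤ d₁ → 1 ℕ.≤ d₂ →
                           Inverse (S ↾ OnHyperplane) ((𝔽² ↾ Zeros) ×.×ₛ setoid)
      hyperplane-inverse 1≤d₁ 1≤d₂ = strictInverse
        (λ (((α , β , γ , κ) , eqP , eqQ) , α≈0) →
          ((β , γ) ,
            trans (evalXZ-cong P (sym α≈0) refl) (trans (sym eqP) (0^-zero 1≤d₁ α≈0 β)) ,
            trans (evalXYZ-cong Q (sym α≈0) refl refl) (trans (sym eqQ) (0^-zero 1≤d₂ α≈0 κ))) , κ)
        (λ (((β , γ) , P≈0 , Q≈0) , κ) →
          ((0# , β , γ , κ) , trans (0^-zero 1≤d₁ refl β) (sym P≈0) , trans (0^-zero 1≤d₂ refl κ) (sym Q≈0)) , refl)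
        (λ (_ , β≈ , γ≈ , κ≈) → (β≈ , γ≈) , κ≈)
        (λ ((β≈ , γ≈) , κ≈) → refl , β≈ , γ≈ , κ≈)
        (λ _ → (refl , refl) , refl)
        (λ (_ , α≈0) → sym α≈0 , refl , refl , refl)

      complement-inverse : Inverse (S ↾ ∁ OnHyperplane) ((setoid ↾ (_≉ 0#)) ×.×ₛ setoid)
      complement-inverse = strictInverse
        (λ (((α , β , γ , κ) , _) , α≉0) → (α , α≉0) , γ)
        (λ ((α , α≉0) , γ) → lift α≉0 γ , α≉0)
        (λ (α≈ , _ , γ≈ , _) → α≈ , γ≈)
        (λ {((α , α≉0) , γ)} {((α′ , α′≉0) , γ′)} (α≈ , γ≈) →
          let β≈ , κ≈ = solution-unique α≉0 (proj₂ (lift α≉0 γ)) (proj₂ (lift α′≉0 γ′)) α≈ γ≈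
          in α≈ , β≈ , γ≈ , κ≈)
        (λ _ → refl , refl)
        (λ (((α , β , γ , κ) , eqs) , α≉0) →
          let β≈ , κ≈ = solution-unique α≉0 (proj₂ (lift α≉0 γ)) eqs refl refl
          in refl , β≈ , refl , κ≈)
        where
        lift : ∀ {α} → α ≉ 0# → Carrier → Setoid.Carrier S
        lift {α} α≉0 γ =
          -- `β` is solved for first, because the second equation involves it.
          let β , eqP = divide (^-≉0 d₁ α≉0) (evalXZ P α γ)
              κ , eqQ = divide (^-≉0 d₂ α≉0) (evalXYZ Q α β γ)
          in (α , β , γ , κ) , eqP , eqQ

      card-solutions : 1 ℕ.≤ d₁ → 1 ℕ.≤ d₂ → HasCardinality (𝔽² ↾ Zeros) m →
                       HasCardinality S (m ℕ.* q ℕ.+ suc r ℕ.* q)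
      card-solutions 1≤d₁ 1≤d₂ Zeros≅m = card-split S
        (λ ((α , _) , _) → α ≟ 0#) (λ (α≈ , _) α≈0 → trans (sym α≈) α≈0)
        (card-transport (hyperplane-inverse 1≤d₁ 1≤d₂) (card-× Zeros≅m F≅2+r))
        (card-transport complement-inverse (card-× (card-remove setoid F≅2+r 0#) F≅2+r))

  -- Plane curves composed of lines and graphs.

  -- The points with `β ≈ b` are parametrised by `γ`. The others keep the condition `β ≉ b`, so that
  -- several lines can be split off in turn without counting a point twice.
  card-line : {A : Pred (Carrier × Carrier) ℓ} (b : Carrier) → (∀ {β} γ → β ≈ b → A (β , γ)) →
              HasCardinality (𝔽² ↾ A ∩ λ (β , _) → β ≉ b) m → HasCardinality (𝔽² ↾ A) (q ℕ.+ m)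
  card-line {A = A} b line rest≅m = card-split (𝔽² ↾ A)
    (λ ((β , _) , _) → β ≟ b) (λ (β≈ , _) β≈b → trans (sym β≈) β≈b)
    (card-transport (strictInverse
      (λ (((_ , γ) , _) , _) → γ) (λ γ → ((b , γ) , line γ refl) , refl)
      proj₂ (λ γ≈ → refl , γ≈) (λ _ → refl) (λ (_ , β≈b) → sym β≈b , refl)) F≅2+r)
    (card-transport (strictInverse
      (λ ((x , Ax) , β≉b) → x , Ax , β≉b) (λ (x , Ax , β≉b) → (x , Ax) , β≉b)
      id id (λ _ → refl , refl) (λ _ → refl , refl)) rest≅m)

  -- Projection to `β` is inverted by `β ↦ (β , h β)`.
  card-graph : {A : Pred (Carrier × Carrier) ℓ} {B : Pred Carrier p} (h : Carrier → Carrier) →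
               Congruent _≈_ _≈_ h →
               (∀ {β γ} → A (β , γ) → B β × γ ≈ h β) → (∀ {β} → B β → A (β , h β)) →
               HasCardinality (setoid ↾ B) m → HasCardinality (𝔽² ↾ A) m
  card-graph h h-cong A⇒graph graph⇒A = card-transport (strictInverse
    (λ ((β , _) , Aβγ) → β , proj₁ (A⇒graph Aβγ)) (λ (β , Bβ) → (β , h β) , graph⇒A Bβ)
    proj₁ (λ β≈ → β≈ , h-cong β≈)
    (λ _ → refl) (λ (_ , Aβγ) → refl , sym (proj₂ (A⇒graph Aβγ))))

  square-zero : ∀ {x} → x ^ 2 ≈ 0# → x ≈ 0#
  square-zero {x} x²≈0 with x ≟ 0#
  ... | yes x≈0 = x≈0
  ... | no x≉0  = contradiction x²≈0 (^-≉0 2 x≉0)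

  factor-square : ∀ β γ → β ^ 2 - γ * β ≈ β * (β - γ)
  factor-square β γ = begin
    β * (β * 1#) - γ * β  ≈⟨ +-congʳ (*-congˡ (*-identityʳ β)) ⟩
    β * β - γ * β         ≈⟨ [y-z]x≈yx-zx β β γ ⟨
    (β - γ) * β           ≈⟨ *-comm _ β ⟩
    β * (β - γ)           ∎

  -- The cofactor of x - 1 in x³ - 1.
  cubeFactor : Carrier → Carrier
  cubeFactor x = x ^ 2 + x + 1#

  cubeFactor-cong : Congruent _≈_ _≈_ cubeFactor
  cubeFactor-cong x≈y = +-congʳ (+-cong (^-congˡ 2 x≈y) x≈y)

  -- Both `β ^ 4 - β` and `β ^ 2 - β` are divisible by `β * (β - 1#)`. To stay within semiring
  -- identities, `β` is replaced by `δ + 1#` and the subtracted `β` is moved to the other side;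
  -- `difference` moves it back.
  factor-quartic : ∀ β γ → β ^ 4 - β + γ * (β ^ 2 - β) ≈ β * ((β - 1#) * (γ + cubeFactor β))
  factor-quartic β γ = begin
    β ^ 4 - β + γ * (β ^ 2 - β)                   ≈⟨ +-cong (difference quartic) (*-congˡ (difference square)) ⟩
    β * (δ * cubeFactor β) + γ * (β * δ)          ≈⟨ solve 4 (λ β δ γ k →
      β :* (δ :* k) :+ γ :* (β :* δ) := β :* (δ :* (γ :+ k))) refl β δ γ (cubeFactor β) ⟩
    β * (δ * (γ + cubeFactor β))                  ∎
    where
    δ = β - 1#
    β≈δ+1 : β ≈ δ + 1#
    β≈δ+1 = sym (//-rightDividesˡ 1# β)
    difference : ∀ {x y} → x ≈ y + β → x - β ≈ y
    difference {x} {y} x≈ = trans (+-congʳ x≈) (//-rightDividesʳ β y)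
    square : β ^ 2 ≈ β * δ + β
    square = begin
      β ^ 2           ≈⟨ *-congˡ (trans (*-identityʳ β) β≈δ+1) ⟩
      β * (δ + 1#)    ≈⟨ solve 2 (λ β δ → β :* (δ :+ con 1) := β :* δ :+ β) refl β δ ⟩
      β * δ + β       ∎
    quartic : β ^ 4 ≈ β * (δ * cubeFactor β) + β
    quartic = begin
      β ^ 4                                            ≈⟨ ^-congˡ 4 β≈δ+1 ⟩
      (δ + 1#) ^ 4                                     ≈⟨ solve 1 (λ δ → let β = δ :+ con 1 in
        β :^ 4 := β :* (δ :* (β :^ 2 :+ β :+ con 1)) :+ β) refl δ ⟩
      (δ + 1#) * (δ * cubeFactor (δ + 1#)) + (δ + 1#)  ≈⟨
        +-cong (*-cong β≈δ+1 (*-congˡ (cubeFactor-cong β≈δ+1))) β≈δ+1 ⟨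
      β * (δ * cubeFactor β) + β                       ∎

  -1≉0 : ∀ {β} → β ≉ 1# → β - 1# ≉ 0#
  -1≉0 {β} β≉1 = β≉1 ∘ x∙y⁻¹≈ε⇒x≈y β 1#

  -- Values of P(0,Z) and Q(0,Y,Z) through evaluation homomorphisms.

  private
    id-hom : RingMorphisms.IsRingHomomorphism 𝔽 𝔽 id
    id-hom = IdentityMorphism.isRingHomomorphism 𝔽 refl

  evalZ : Carrier → RawRing.Carrier 𝔽[Z] → Carrier
  evalZ = evalAlong 𝔽 (commutativeRing F) id id-hom

  evalZ-hom : ∀ γ → RingMorphisms.IsRingHomomorphism 𝔽[Z] 𝔽 (evalZ γ)
  evalZ-hom = evalAlong-isRingHomomorphism 𝔽 (commutativeRing F) id id-hom

  evalZ-Z : ∀ γ → evalZ γ Z₁ ≈ γ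
  evalZ-Z = evalAlong-indeterminate 𝔽 (commutativeRing F) id id-hom

  evalZ-eval : ∀ p γ → evalZ γ p ≡ eval 𝔽 γ p
  evalZ-eval p γ = ≡.cong (eval 𝔽 γ) (map-id p)

  module _ (γ β : Carrier) where
    evalZY : RawRing.Carrier 𝔽[Z,Y] → Carrier
    evalZY = evalAlong 𝔽[Z] (commutativeRing F) (evalZ γ) (evalZ-hom γ) β

    evalZY-hom : RingMorphisms.IsRingHomomorphism 𝔽[Z,Y] 𝔽 evalZY
    evalZY-hom = evalAlong-isRingHomomorphism 𝔽[Z] (commutativeRing F) (evalZ γ) (evalZ-hom γ) β

    open RingMorphisms.IsRingHomomorphism evalZY-hom public using (+-homo; *-homo; ⟦⟧-cong)

    evalZY-Y : evalZY Y₂ ≈ β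
    evalZY-Y = evalAlong-indeterminate 𝔽[Z] (commutativeRing F) (evalZ γ) (evalZ-hom γ) β

    evalZY-Y^ : ∀ k → evalZY (Y₂ ^₂ k) ≈ β ^ k
    evalZY-Y^ k = trans (^-homo {A = commutativeRing F} evalZY-hom Y₂ k) (^-congˡ k evalZY-Y)

    evalZY-Z : evalZY Z₂ ≈ γ
    evalZY-Z = trans (evalAlong-constant 𝔽[Z] (commutativeRing F) (evalZ γ) (evalZ-hom γ) β Z₁) (evalZ-Z γ)

    evalZY-minus : ∀ s t {x y} → evalZY s ≈ x → evalZY t ≈ y → evalZY (s -₂ t) ≈ x - y
    evalZY-minus s t s≈ t≈ = trans (minus-homo {A = commutativeRing F} evalZY-hom s t) (+-cong s≈ (-‿cong t≈))

    -- Both sides put zero for X in the coefficients, then evaluate in Z and in Y; they differ in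
    -- whether `Q` is traversed once or twice.
    evalZY-Q : ∀ Q → evalXYZ Q 0# β γ ≡ evalZY (Q ⟨0,Y,Z⟩)
    evalZY-Q Q = ≡.cong (eval 𝔽 β) (≡.trans
      (map-cong (λ r → ≡.sym (evalZ-eval (r ⟨0,Z⟩) γ)) Q) (map-∘ Q))

  module _ (P : RawRing.Carrier 𝔽[X,Z]) where

    private
      -- P(0,Z) is known only up to equality of coefficients, which evaluation respects. The value
      -- of `s` can then be computed from the homomorphism laws.
      evalXZ-0 : ∀ γ s → P ⟨0,Z⟩ ≈₁ s → evalXZ P 0# γ ≈ evalZ γ s
      evalXZ-0 γ s P≈ = trans (reflexive (≡.sym (evalZ-eval (P ⟨0,Z⟩) γ)))
        (RingMorphisms.IsRingHomomorphism.⟦⟧-cong (evalZ-hom γ) {P ⟨0,Z⟩} {s} P≈)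

      evalZ-Z^ : ∀ γ k → evalZ γ (Z₁ ^₁ k) ≈ γ ^ k
      evalZ-Z^ γ k = trans (^-homo {A = commutativeRing F} (evalZ-hom γ) Z₁ k) (^-congˡ k (evalZ-Z γ))

    evalXZ-square : P ⟨0,Z⟩ ≈₁ Z₁ ^₁ 2 → ∀ γ → evalXZ P 0# γ ≈ γ ^ 2
    evalXZ-square P≈ γ = trans (evalXZ-0 γ (Z₁ ^₁ 2) P≈) (evalZ-Z^ γ 2)

    evalXZ-fermat : P ⟨0,Z⟩ ≈₁ Z₁ ^₁ q -₁ Z₁ → ∀ γ → evalXZ P 0# γ ≈ 0#
    evalXZ-fermat P≈ γ = begin
      evalXZ P 0# γ                  ≈⟨ evalXZ-0 γ (Z₁ ^₁ q -₁ Z₁) P≈ ⟩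
      evalZ γ (Z₁ ^₁ q -₁ Z₁)        ≈⟨ minus-homo {A = commutativeRing F} (evalZ-hom γ) (Z₁ ^₁ q) Z₁ ⟩
      evalZ γ (Z₁ ^₁ q) - evalZ γ Z₁ ≈⟨ +-cong (evalZ-Z^ γ q) (-‿cong (evalZ-Z γ)) ⟩
      γ ^ q - γ                      ≈⟨ x≈y⇒x∙y⁻¹≈ε (fermat F F≅2+r γ) ⟩
      0#                             ∎

  module _ (Q : RawRing.Carrier 𝔽[X,Z,Y]) where

    private
      evalXYZ-0 : ∀ β γ s → Q ⟨0,Y,Z⟩ ≈₂ s → evalXYZ Q 0# β γ ≈ evalZY γ β s
      evalXYZ-0 β γ s Q≈ = trans (reflexive (evalZY-Q γ β Q)) (⟦⟧-cong γ β {Q ⟨0,Y,Z⟩} {s} Q≈)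

    evalXYZ-square : Q ⟨0,Y,Z⟩ ≈₂ Y₂ ^₂ 2 → ∀ β γ → evalXYZ Q 0# β γ ≈ β ^ 2
    evalXYZ-square Q≈ β γ = trans (evalXYZ-0 β γ (Y₂ ^₂ 2) Q≈) (evalZY-Y^ γ β 2)

    evalXYZ-lines : Q ⟨0,Y,Z⟩ ≈₂ Y₂ ^₂ 2 -₂ Z₂ *₂ Y₂ →
                    ∀ β γ → evalXYZ Q 0# β γ ≈ β * (β - γ)
    evalXYZ-lines Q≈ β γ = begin
      evalXYZ Q 0# β γ                    ≈⟨ evalXYZ-0 β γ (Y₂ ^₂ 2 -₂ Z₂ *₂ Y₂) Q≈ ⟩
      evalZY γ β (Y₂ ^₂ 2 -₂ Z₂ *₂ Y₂)    ≈⟨ evalZY-minus γ β (Y₂ ^₂ 2) (Z₂ *₂ Y₂) (evalZY-Y^ γ β 2)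
        (trans (*-homo γ β Z₂ Y₂) (*-cong (evalZY-Z γ β) (evalZY-Y γ β))) ⟩
      β ^ 2 - γ * β                       ≈⟨ factor-square β γ ⟩
      β * (β - γ)                         ∎

    evalXYZ-quartic : Q ⟨0,Y,Z⟩ ≈₂ Y₂ ^₂ 4 -₂ Y₂ +₂ Z₂ *₂ (Y₂ ^₂ 2 -₂ Y₂) →
                      ∀ β γ → evalXYZ Q 0# β γ ≈ β * ((β - 1#) * (γ + cubeFactor β))
    evalXYZ-quartic Q≈ β γ = begin
      evalXYZ Q 0# β γ                              ≈⟨ evalXYZ-0 β γ (Y₂ ^₂ 4 -₂ Y₂ +₂ Z₂ *₂ (Y₂ ^₂ 2 -₂ Y₂)) Q≈ ⟩
      evalZY γ β (Y₂ ^₂ 4 -₂ Y₂ +₂ Z₂ *₂ (Y₂ ^₂ 2 -₂ Y₂))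
        ≈⟨ +-homo γ β (Y₂ ^₂ 4 -₂ Y₂) (Z₂ *₂ (Y₂ ^₂ 2 -₂ Y₂)) ⟩
      evalZY γ β (Y₂ ^₂ 4 -₂ Y₂) + evalZY γ β (Z₂ *₂ (Y₂ ^₂ 2 -₂ Y₂))
        ≈⟨ +-cong (Y^-Y 4) (trans (*-homo γ β Z₂ (Y₂ ^₂ 2 -₂ Y₂)) (*-cong (evalZY-Z γ β) (Y^-Y 2))) ⟩
      β ^ 4 - β + γ * (β ^ 2 - β)                   ≈⟨ factor-quartic β γ ⟩
      β * ((β - 1#) * (γ + cubeFactor β))           ∎
      where
      Y^-Y : ∀ k → evalZY γ β (Y₂ ^₂ k -₂ Y₂) ≈ β ^ k - β
      Y^-Y k = evalZY-minus γ β (Y₂ ^₂ k) Y₂ (evalZY-Y^ γ β k) (evalZY-Y γ β)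

  -- Point counts of the four curves over α = 0.

  module _ (P : RawRing.Carrier 𝔽[X,Z]) (Q : RawRing.Carrier 𝔽[X,Z,Y]) where

    card-zeros-point : (∀ γ → evalXZ P 0# γ ≈ γ ^ 2) → (∀ β γ → evalXYZ Q 0# β γ ≈ β ^ 2) →
                       HasCardinality (𝔽² ↾ Zeros P Q) 1
    -- The point is the graph of the zero function over the singleton `β ≈ 0#`.
    card-zeros-point P≈ Q≈ = card-graph (λ _ → 0#) (λ _ → refl)
      (λ {β} {γ} (P≈0 , Q≈0) → square-zero (trans (sym (Q≈ β γ)) Q≈0) , square-zero (trans (sym (P≈ γ)) P≈0))
      (λ {β} β≈0 → trans (P≈ 0#) (zeroˡ _) , trans (Q≈ β 0#) (trans (*-congʳ β≈0) (zeroˡ _)))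
      (card-singleton setoid 0#)

    module _ (P≈0 : ∀ γ → evalXZ P 0# γ ≈ 0#) where

      card-zeros-line : (∀ β γ → evalXYZ Q 0# β γ ≈ β ^ 2) →
                        HasCardinality (𝔽² ↾ Zeros P Q) (q ℕ.+ 0)
      card-zeros-line Q≈ = card-line 0#
        (λ {β} γ β≈0 → P≈0 γ , trans (Q≈ β γ) (trans (*-congʳ β≈0) (zeroˡ _)))
        (card-empty 𝔽² (λ (β , γ) ((_ , Q≈0) , β≉0) → β≉0 (square-zero (trans (sym (Q≈ β γ)) Q≈0))))

      -- The second line `γ ≈ β` is counted as a graph over `β ≉ 0#` only, since the origin already
      -- lies on the first.
      card-zeros-two-lines : (∀ β γ → evalXYZ Q 0# β γ ≈ β * (β - γ)) →
                             HasCardinality (𝔽² ↾ Zeros P Q) (q ℕ.+ suc r)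
      card-zeros-two-lines Q≈ = card-line 0#
        (λ {β} γ β≈0 → P≈0 γ , trans (Q≈ β γ) (trans (*-congʳ β≈0) (zeroˡ _)))
        (card-graph id id
          (λ {β} {γ} ((_ , Q≈0) , β≉0) →
            β≉0 , sym (x∙y⁻¹≈ε⇒x≈y β γ (*≈0⇒≈0 β≉0 (trans (sym (Q≈ β γ)) Q≈0))))
          (λ {β} β≉0 → (P≈0 β , trans (Q≈ β β) (trans (*-congˡ (-‿inverseʳ β)) (zeroʳ β))) , β≉0)
          (card-remove setoid F≅2+r 0#))

      card-zeros-quartic : (∀ β γ → evalXYZ Q 0# β γ ≈ β * ((β - 1#) * (γ + cubeFactor β))) →
                           HasCardinality (𝔽² ↾ Zeros P Q) (q ℕ.+ (q ℕ.+ r))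
      card-zeros-quartic Q≈ = card-line 0#
        (λ {β} γ β≈0 → P≈0 γ , trans (Q≈ β γ) (trans (*-congʳ β≈0) (zeroˡ _)))
        (card-line 1#
          (λ {β} γ β≈1 → (P≈0 γ , (begin
            evalXYZ Q 0# β γ                     ≈⟨ Q≈ β γ ⟩
            β * ((β - 1#) * (γ + cubeFactor β))  ≈⟨ *-congˡ (*-congʳ (x≈y⇒x∙y⁻¹≈ε β≈1)) ⟩
            β * (0# * (γ + cubeFactor β))        ≈⟨ trans (*-congˡ (zeroˡ _)) (zeroʳ β) ⟩
            -- The lines `β ≈ 0#` and `β ≈ 1#` are disjoint, so the second survives whole after the
            -- first is removed.
            0#                                   ∎)) , λ β≈0 → 1≉0 (trans (sym β≈1) β≈0))
          (card-graph (λ β → - cubeFactor β) (λ β≈ → -‿cong (cubeFactor-cong β≈))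
            (λ {β} {γ} (((_ , Q≈0) , β≉0) , β≉1) → (β≉0 , β≉1) ,
              +-inverseˡ-unique γ (cubeFactor β)
                (*≈0⇒≈0 (-1≉0 β≉1) (*≈0⇒≈0 β≉0 (trans (sym (Q≈ β γ)) Q≈0))))
            (λ {β} (β≉0 , β≉1) → ((P≈0 _ , (begin
              evalXYZ Q 0# β (- cubeFactor β)                        ≈⟨ Q≈ β _ ⟩
              β * ((β - 1#) * (- cubeFactor β + cubeFactor β))       ≈⟨ *-congˡ (*-congˡ (-‿inverseˡ _)) ⟩
              β * ((β - 1#) * 0#)                                    ≈⟨ trans (*-congˡ (zeroʳ _)) (zeroʳ β) ⟩
              0#                                                     ∎)) , β≉0) , β≉1)
            -- `1#` is removed from the field already punctured at `0#`, hence given with its proof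
            -- of being nonzero; this leaves `r` values of `β`.
            (card-∩ setoid (card-remove (setoid ↾ (_≉ 0#)) (card-remove setoid F≅2+r 0#) (1# , 1≉0)))))

-- S_{4+2k}(n) = (k + 1) n² − k n, with the subtracted term moved to the left to
-- avoid truncated subtraction.
polygonal-even : ∀ k n → polygonal (4 ℕ.+ 2 ℕ.* k) n ℕ.+ k ℕ.* n ≡ suc k ℕ.* n ℕ.^ 2
polygonal-even k zero    = base k
  where
  base : ∀ k → k ℕ.* 0 ≡ suc k ℕ.* 0
  base = solve-∀
polygonal-even k (suc n) = begin
  polygonal (4 ℕ.+ 2 ℕ.* k) (suc n) ℕ.+ k ℕ.* suc n        ≡⟨ ≡.cong (ℕ._+ k ℕ.* suc n) last-term ⟩
  polygonal (4 ℕ.+ 2 ℕ.* k) n ℕ.+ term n ℕ.+ k ℕ.* suc n   ≡⟨ regroup (polygonal (4 ℕ.+ 2 ℕ.* k) n) k n ⟩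
  polygonal (4 ℕ.+ 2 ℕ.* k) n ℕ.+ k ℕ.* n ℕ.+ (term n ℕ.+ k) ≡⟨ ≡.cong (ℕ._+ (term n ℕ.+ k)) (polygonal-even k n) ⟩
  suc k ℕ.* n ℕ.^ 2 ℕ.+ (term n ℕ.+ k)                     ≡⟨ square-step k n ⟩
  suc k ℕ.* suc n ℕ.^ 2                                    ∎
  where
  open ≡.≡-Reasoning
  term : ℕ → ℕ
  -- The step `(4 + 2 * k) ∸ 2` reduces to `2 + 2 * k` by computation.
  term i = 1 ℕ.+ i ℕ.* (2 ℕ.+ 2 ℕ.* k)
  -- `upTo` unfolds from the front, whereas the induction needs its last entry split off.
  last-term : polygonal (4 ℕ.+ 2 ℕ.* k) (suc n) ≡ polygonal (4 ℕ.+ 2 ℕ.* k) n ℕ.+ term n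
  last-term = begin
    sum (map term (upTo (suc n)))             ≡⟨ ≡.cong (sum ∘ map term) (upTo-∷ʳ n) ⟨
    sum (map term (upTo n ++ n ∷ []))         ≡⟨ ≡.cong sum (map-++ term (upTo n) (n ∷ [])) ⟩
    sum (map term (upTo n) ++ term n ∷ [])    ≡⟨ sum-++ (map term (upTo n)) (term n ∷ []) ⟩
    sum (map term (upTo n)) ℕ.+ (term n ℕ.+ 0) ≡⟨ ≡.cong (sum (map term (upTo n)) ℕ.+_) (ℕ.+-identityʳ (term n)) ⟩
    sum (map term (upTo n)) ℕ.+ term n        ∎
  regroup : ∀ s k n → s ℕ.+ (1 ℕ.+ n ℕ.* (2 ℕ.+ 2 ℕ.* k)) ℕ.+ k ℕ.* suc n ≡
                         s ℕ.+ k ℕ.* n ℕ.+ (1 ℕ.+ n ℕ.* (2 ℕ.+ 2 ℕ.* k) ℕ.+ k)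
  regroup = solve-∀
  square-step : ∀ k n → suc k ℕ.* (n ℕ.* (n ℕ.* 1)) ℕ.+ (1 ℕ.+ n ℕ.* (2 ℕ.+ 2 ℕ.* k) ℕ.+ k) ≡
                        suc k ℕ.* (suc n ℕ.* (suc n ℕ.* 1))
  square-step = solve-∀

-- The additive form guarantees that the subtraction is not truncated.
≡-∸ : ∀ {m n o} → m ℕ.+ n ≡ o → m ≡ o ℕ.∸ n
≡-∸ {m} {n} m+n≡o = ≡.trans (≡.sym (m+n∸n≡m m n)) (≡.cong (ℕ._∸ n) m+n≡o)

open import Data.Nat.Base using (_+_; _*_; _^_; _∸_; _≤_)

theorem7p2 : ∀ {c ℓ₁ ℓ₂ : Level} (F : HeytingField c ℓ₁ ℓ₂) → let open FieldPolynomials F in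
    ∀ (p n q : ℕ) → Prime p → 1 ≤ n → q ≡ p ^ n → HasCardinality setoid q →
    ∀ (d₁ d₂ : ℕ) → 1 ≤ d₁ → 1 ≤ d₂ →
    ∀ (P : RawRing.Carrier 𝔽[X,Z]) → Monic 𝔽[X] P → DegreeAtLeast 𝔽[X] 2 P →
    ∀ (Q : RawRing.Carrier 𝔽[X,Z,Y]) → Monic 𝔽[X,Z] Q → DegreeAtLeast 𝔽[X,Z] 2 Q →
    let S = solutions d₁ d₂ P Q in
    (P ⟨0,Z⟩ ≈₁ Z₁ ^₁ 2 →
    Q ⟨0,Y,Z⟩ ≈₂ Y₂ ^₂ 2 →
    HasCardinality S (q ^ 2) × q ^ 2 ≡ polygonal 4 q)
    × (P ⟨0,Z⟩ ≈₁ Z₁ ^₁ q -₁ Z₁ →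
    Q ⟨0,Y,Z⟩ ≈₂ Y₂ ^₂ 2 →
    HasCardinality S (2 * q ^ 2 ∸ q) × 2 * q ^ 2 ∸ q ≡ polygonal 6 q)
    × (P ⟨0,Z⟩ ≈₁ Z₁ ^₁ q -₁ Z₁ →
    Q ⟨0,Y,Z⟩ ≈₂ Y₂ ^₂ 2 -₂ Z₂ *₂ Y₂ →
    HasCardinality S (3 * q ^ 2 ∸ 2 * q) × 3 * q ^ 2 ∸ 2 * q ≡ polygonal 8 q)
    × (P ⟨0,Z⟩ ≈₁ Z₁ ^₁ q -₁ Z₁ →
    Q ⟨0,Y,Z⟩ ≈₂ Y₂ ^₂ 4 -₂ Y₂ +₂ Z₂ *₂ (Y₂ ^₂ 2 -₂ Y₂) →
    HasCardinality S (4 * q ^ 2 ∸ 3 * q) × 4 * q ^ 2 ∸ 3 * q ≡ polygonal 10 q)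
-- Cardinalities 0 and 1 are excluded by the existence of `0#` and by `1≉0`, which leaves the form
-- `2 + r` required by `Counting`.
theorem7p2 F p n zero _ _ _ F≅0 with Inverse.to F≅0 (HeytingField.0# F)
... | ()
theorem7p2 F p n (suc zero) _ _ _ F≅1 = contradiction
  (Inverse⇒Injection F≅1 .Injection.injective {HeytingField.1# F} {HeytingField.0# F} (Fin1-trivial _ _))
  (FiniteField.1≉0 F F≅1)
  where
  Fin1-trivial : (i j : Fin 1) → i ≡ j
  Fin1-trivial zero zero = ≡.refl
theorem7p2 F p n q@(suc (suc r)) _ _ _ F≅q d₁ d₂ 1≤d₁ 1≤d₂ P _ _ Q _ _ =
    (λ P≈ Q≈ →
      result (card-zeros-point P Q (evalXZ-square P P≈) (evalXYZ-square Q Q≈)) (square-count r)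
    , square-polygonal q)
  , (λ P≈ Q≈ →
      result (card-zeros-line P Q (evalXZ-fermat P P≈) (evalXYZ-square Q Q≈)) (≡-∸ (hexagonal-count r))
    -- The general identity has `1 * q` where the statement subtracts `q`.
    , ≡.sym (≡-∸ (≡.trans (≡.cong (polygonal 6 q +_) (≡.sym (ℕ.*-identityˡ q))) (polygonal-even 1 q))))
  , (λ P≈ Q≈ →
      result (card-zeros-two-lines P Q (evalXZ-fermat P P≈) (evalXYZ-lines Q Q≈)) (≡-∸ (octagonal-count r))
    , ≡.sym (≡-∸ (polygonal-even 2 q)))
  , (λ P≈ Q≈ →
      result (card-zeros-quartic P Q (evalXZ-fermat P P≈) (evalXYZ-quartic Q Q≈)) (≡-∸ (decagonal-count r))
    , ≡.sym (≡-∸ (polygonal-even 3 q)))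
  where
  open Counting F F≅q

  result : ∀ {m N} → HasCardinality (𝔽² ↾ Zeros P Q) m → m * q + suc r * q ≡ N →
           HasCardinality (FieldPolynomials.solutions F d₁ d₂ P Q) N
  result Zeros≅m ≡.refl = card-solutions P Q 1≤d₁ 1≤d₂ Zeros≅m

  square-polygonal : ∀ n → n ^ 2 ≡ polygonal 4 n
  square-polygonal n = begin
    n ^ 2                ≡⟨ ℕ.*-identityˡ (n ^ 2) ⟨
    1 * n ^ 2            ≡⟨ polygonal-even 0 n ⟨
    polygonal 4 n + 0    ≡⟨ ℕ.+-identityʳ _ ⟩
    polygonal 4 n        ∎
    where open ≡.≡-Reasoning

  -- In this and the next three identities the first factor is the number of points of the curve, in
  -- the shape its count produced; `q * (q * 1)` is `q ^ 2` unfolded.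
  square-count : ∀ r → let q = suc (suc r) in 1 * q + suc r * q ≡ (q * (q * 1))
  square-count = solve-∀

  hexagonal-count : ∀ r → let q = suc (suc r) in (q + 0) * q + suc r * q + q ≡ 2 * (q * (q * 1))
  hexagonal-count = solve-∀

  octagonal-count : ∀ r → let q = suc (suc r) in (q + suc r) * q + suc r * q + 2 * q ≡ 3 * (q * (q * 1))
  octagonal-count = solve-∀

  decagonal-count : ∀ r → let q = suc (suc r) in (q + (q + r)) * q + suc r * q + 3 * q ≡ 4 * (q * (q * 1))
  decagonal-count = solve-∀
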